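{- The set $\mathcal{Y}_F$ is exactly the set of balanced words in $\{0,1\}^{\mathbb{N}}$.
   Context: Let $\mathcal{A}=\{0,1\}$. For a finite word $v=v_1\cdots v_n$ over $\mathcal{A}$, $\tilde v=v_n\cdots v_1$ is its mirror word (with $\tilde\lambda=\lambda$ for the empty word). Let $F=\{0v01\tilde v1,\ 1\tilde v10v0 : v\in\mathcal{A}^*\}$, and let $\mathcal{Y}_F$ be the set of right-infinite words $\mathbf{y}\in\mathcal{A}^{\mathbb{N}}$ none of whose finite factors belongs to $F$. A (finite or infinite) word $\mathbf{x}$ is balanced if $\bigl||u|_1-|v|_1\bigr|\le1$ for all factors $u,v$ of $\mathbf{x}$ with $|u|=|v|$, where $|u|$ is the length of $u$ and $|u|_1$ the number of occurrences of $1$ in $u$. -}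

module Defs where

open import Data.Nat using (ℕ; zero; suc; _≤_; ∣_-_∣)
open import Data.List using (List; []; _∷_; _++_; reverse; [_])
open import Data.Product using (Σ; _×_)
open import Data.Sum using (_⊎_)
open import Relation.Binary.PropositionalEquality using (_≡_)
open import Relation.Nullary using (¬_)

data 𝒜 : Set where
  𝟎 𝟏 : 𝒜

Word : Set
Word = List 𝒜

InfWord : Set
InfWord = ℕ → 𝒜

mirror : Word → Word
mirror = reverse

factor : InfWord → ℕ → ℕ → Word
factor y i zero    = []
factor y i (suc n) = y i ∷ factor y (suc i) n

InF : Word → Set
InF w = Σ Word (λ v → w ≡ 𝟎 ∷ v ++ 𝟎 ∷ 𝟏 ∷ mirror v ++ [ 𝟏 ])
      ⊎ Σ Word (λ v → w ≡ 𝟏 ∷ mirror v ++ 𝟏 ∷ 𝟎 ∷ v ++ [ 𝟎 ])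

InYF : InfWord → Set
InYF y = ∀ (i n : ℕ) → ¬ InF (factor y i n)

count₁ : Word → ℕ
count₁ []       = 0
count₁ (𝟎 ∷ u) = count₁ u
count₁ (𝟏 ∷ u) = suc (count₁ u)

Balanced : InfWord → Set
Balanced y = ∀ (i j n : ℕ) → ∣ count₁ (factor y i n) - count₁ (factor y j n) ∣ ≤ 1

{-# OPTIONS --safe #-}
{-
An imbalance of minimal length n consists of occurrences of a p a and b p b, where p is a palindrome
and {a , b} = {0 , 1}.  By symmetry let a p a come first, at 0, and take the closest such pair, with
b p b at j + 1.  All windows of length n strictly in between then have the same weight, so the word
has period n there.  The two occurrences cannot overlap.  If they are adjacent, a p a b p b lies in F.
If they are further apart, then outward from the centre (j , j + 1), which carries a b, the two
readings must agree all the way back to position 0: a disagreement with a on the left is forbidden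
at this centre, one with b on the left at the centre (j + n , j + n + 1), which carries b a.  But
then the letter a at 0, reflected, makes a forbidden disagreement at the latter centre.
Conversely, the words of F split into two halves of equal length with weights differing by 2.
-}
module Submission where

open import Defs
open import Data.Empty using (⊥; ⊥-elim)
open import Data.List using ([]; _∷_; _++_; _∷ʳ_; [_]; length; reverse)
open import Data.List.Properties using (∷-injective; ++-assoc; length-++; length-reverse;
  unfold-reverse; reverse-involutive)
open import Data.Nat using (ℕ; zero; suc; _+_; _≤_; _<_; z≤n; s≤s; ∣_-_∣; _≤?_; compare; less; equal; greater)
open import Data.Nat.Induction using (<-rec)
open import Data.Nat.Properties
open import Data.Nat.Tactic.RingSolver using (solve-∀)
open import Data.Product using (_×_; _,_; proj₁; proj₂)
open import Data.Sum using (_⊎_; inj₁; inj₂)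
open import Relation.Binary.PropositionalEquality hiding ([_])
open import Relation.Nullary using (yes; no)

-- Letters and their occurrences in finite words.

opp : 𝒜 → 𝒜
opp 𝟎 = 𝟏
opp 𝟏 = 𝟎

opp≢ : ∀ b → opp b ≢ b
opp≢ 𝟎 ()
opp≢ 𝟏 ()

opp-or-same : ∀ b x → x ≡ opp b ⊎ x ≡ b
opp-or-same 𝟎 𝟎 = inj₂ refl
opp-or-same 𝟎 𝟏 = inj₁ refl
opp-or-same 𝟏 𝟎 = inj₁ refl
opp-or-same 𝟏 𝟏 = inj₂ refl

δ : 𝒜 → 𝒜 → ℕ
δ 𝟎 𝟎 = 1
δ 𝟎 𝟏 = 0
δ 𝟏 𝟎 = 0
δ 𝟏 𝟏 = 1

δ-injective : ∀ b {x x′} → δ b x ≡ δ b x′ → x ≡ x′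
δ-injective 𝟎 {𝟎} {𝟎} _ = refl
δ-injective 𝟎 {𝟏} {𝟏} _ = refl
δ-injective 𝟏 {𝟎} {𝟎} _ = refl
δ-injective 𝟏 {𝟏} {𝟏} _ = refl

δ≤1 : ∀ b x → δ b x ≤ 1
δ≤1 𝟎 𝟎 = ≤-refl
δ≤1 𝟎 𝟏 = z≤n
δ≤1 𝟏 𝟎 = z≤n
δ≤1 𝟏 𝟏 = ≤-refl

δ-jump : ∀ b {x x′} → suc (δ b x) ≤ δ b x′ → x ≡ opp b × x′ ≡ b
δ-jump 𝟎 {𝟏} {𝟎} _ = refl , refl
δ-jump 𝟏 {𝟎} {𝟏} _ = refl , refl
δ-jump 𝟎 {𝟎} {𝟎} (s≤s ())
δ-jump 𝟏 {𝟏} {𝟏} (s≤s ())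

-- The counted letter is a parameter so that one argument serves both orders of the two windows:
-- exchanging letters turns a fall into a rise.
occ : 𝒜 → Word → ℕ
occ b []      = 0
occ b (x ∷ w) = δ b x + occ b w

occ-𝟏 : ∀ w → occ 𝟏 w ≡ count₁ w
occ-𝟏 []      = refl
occ-𝟏 (𝟎 ∷ w) = occ-𝟏 w
occ-𝟏 (𝟏 ∷ w) = cong suc (occ-𝟏 w)

occ-++ : ∀ b u w → occ b (u ++ w) ≡ occ b u + occ b w
occ-++ b []      w = refl
occ-++ b (x ∷ u) w = trans (cong (δ b x +_) (occ-++ b u w)) (sym (+-assoc (δ b x) _ _))

occ-reverse : ∀ b w → occ b (reverse w) ≡ occ b w
occ-reverse b []      = refl
occ-reverse b (x ∷ w) = begin
  occ b (reverse (x ∷ w))          ≡⟨ cong (occ b) (unfold-reverse x w) ⟩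
  occ b (reverse w ∷ʳ x)           ≡⟨ occ-++ b (reverse w) [ x ] ⟩
  occ b (reverse w) + (δ b x + 0)  ≡⟨ cong₂ _+_ (occ-reverse b w) (+-identityʳ (δ b x)) ⟩
  occ b w + δ b x                  ≡⟨ +-comm (occ b w) _ ⟩
  δ b x + occ b w                  ∎
  where open ≡-Reasoning

occ-total : ∀ w → occ 𝟎 w + occ 𝟏 w ≡ length w
occ-total []      = refl
occ-total (𝟎 ∷ w) = cong suc (occ-total w)
occ-total (𝟏 ∷ w) = trans (+-suc (occ 𝟎 w) _) (cong suc (occ-total w))

-- Factors of an infinite word.

module _ (y : InfWord) where

  length-factor : ∀ i n → length (factor y i n) ≡ n
  length-factor i zero    = refl
  length-factor i (suc n) = cong suc (length-factor (suc i) n)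

  factor-+ : ∀ i m n → factor y i (m + n) ≡ factor y i m ++ factor y (i + m) n
  factor-+ i zero    n = cong (λ k → factor y k n) (sym (+-identityʳ i))
  factor-+ i (suc m) n = cong (y i ∷_)
    (trans (factor-+ (suc i) m n)
           (cong (λ k → factor y (suc i) m ++ factor y k n) (sym (+-suc i m))))

  factor-∷ʳ : ∀ i n → factor y i (suc n) ≡ factor y i n ∷ʳ y (i + n)
  factor-∷ʳ i n = trans (cong (factor y i) (+-comm 1 n)) (factor-+ i n 1)

  factor-++⁻ : ∀ i n u w → factor y i n ≡ u ++ w →
    factor y i (length u) ≡ u × factor y (i + length u) (length w) ≡ w
  factor-++⁻ i n [] w eq = refl ,
    trans (cong₂ (factor y) (+-identityʳ i) (trans (cong length (sym eq)) (length-factor i n))) eq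
  factor-++⁻ i (suc n) (x ∷ u) w eq with ∷-injective eq
  ... | yi≡x , eq′ with factor-++⁻ (suc i) n u w eq′
  ... | p , q = cong₂ _∷_ yi≡x p ,
    trans (cong (λ k → factor y k (length w)) (+-suc i (length u))) q

  -- Mirror positions are encoded by offsets with a fixed sum, which avoids subtraction; palindromes
  -- below use the same form.
  factor-reverse : ∀ s p q → (∀ t u → suc (t + u) ≡ s → y (p + t) ≡ y (q + u)) →
    factor y q s ≡ reverse (factor y p s)
  factor-reverse zero    p q h = refl
  factor-reverse (suc s) p q h = begin
    factor y q (suc s)                      ≡⟨ factor-∷ʳ q s ⟩
    factor y q s ∷ʳ y (q + s)               ≡⟨ cong₂ _∷ʳ_ ih last ⟩
    reverse (factor y (suc p) s) ∷ʳ y p     ≡⟨ unfold-reverse (y p) (factor y (suc p) s) ⟨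
    reverse (factor y p (suc s))            ∎
    where
    open ≡-Reasoning
    ih = factor-reverse s (suc p) q λ t u e →
      trans (cong y (sym (+-suc p t))) (h (suc t) u (cong suc e))
    last : y (q + s) ≡ y p
    last = sym (trans (cong y (sym (+-identityʳ p))) (h 0 s refl))

-- Forbidden words seen from a centre.

-- Around any centre (c , suc c) carrying a b, the first disagreement between the two outward
-- readings is not a on the left against b on the right.
NoF : 𝒜 → 𝒜 → InfWord → Set
NoF a b y = ∀ c l s → l + suc s ≡ c → y l ≡ a → y c ≡ a → y (suc c) ≡ b → y (suc c + suc s) ≡ b →
  (∀ x u → suc (x + u) ≡ s → y (l + suc x) ≡ y (suc c + suc u)) → ⊥

module _ {y : InfWord} (yF : InYF y) where

  private
    window : ∀ a b c l s → l + suc s ≡ c →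
      y l ≡ a → y c ≡ a → y (suc c) ≡ b → y (suc c + suc s) ≡ b →
      (∀ x u → suc (x + u) ≡ s → y (l + suc x) ≡ y (suc c + suc u)) →
      let v = factor y (suc l) s in
      factor y l (suc s + (2 + suc s)) ≡ a ∷ v ++ a ∷ b ∷ mirror v ++ [ b ]
    window a b c l s refl yl yc yc′ yr agree = begin
      factor y l (suc s + (2 + suc s))
        ≡⟨ factor-+ y l (suc s) _ ⟩
      y l ∷ v ++ y c ∷ y (suc c) ∷ factor y (2 + c) (suc s)
        ≡⟨ cong (λ w → y l ∷ v ++ y c ∷ y (suc c) ∷ w) (factor-∷ʳ y (2 + c) s) ⟩
      y l ∷ v ++ y c ∷ y (suc c) ∷ factor y (2 + c) s ∷ʳ y (2 + c + s)
        ≡⟨ cong (λ w → y l ∷ v ++ y c ∷ y (suc c) ∷ w)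
             (cong₂ _∷ʳ_ mir (trans (cong y (sym (+-suc (suc c) s))) yr)) ⟩
      y l ∷ v ++ y c ∷ y (suc c) ∷ mirror v ++ [ b ]
        ≡⟨ cong₂ (λ p q → p ∷ v ++ q) yl (cong₂ (λ p q → p ∷ q ∷ mirror v ++ [ b ]) yc yc′) ⟩
      a ∷ v ++ a ∷ b ∷ mirror v ++ [ b ] ∎
      where
      open ≡-Reasoning
      v = factor y (suc l) s
      mir : factor y (2 + c) s ≡ mirror v
      mir = factor-reverse y s (suc l) (2 + c) λ t u e →
        trans (cong y (sym (+-suc l t))) (trans (agree t u e) (cong y (+-suc (suc c) u)))

  noF : ∀ a b → a ≢ b → NoF a b y
  noF 𝟎 𝟎 a≢b = ⊥-elim (a≢b refl)
  noF 𝟏 𝟏 a≢b = ⊥-elim (a≢b refl)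
  noF 𝟎 𝟏 _ c l s e p q r t h = yF l _ (inj₁ (_ , window 𝟎 𝟏 c l s e p q r t h))
  -- In this family the mirror word stands first, so the parameter is `mirror v`.
  noF 𝟏 𝟎 _ c l s e p q r t h = yF l _ (inj₂ (mirror v , trans (window 𝟏 𝟎 c l s e p q r t h)
    (cong (λ w → 𝟏 ∷ w ++ 𝟏 ∷ 𝟎 ∷ mirror v ++ [ 𝟎 ]) (sym (reverse-involutive v)))))
    where
    v = factor y (suc l) s

-- Allows the lighter window of an imbalance to be moved to position 0.
InYF-shift : ∀ {y} → InYF y → ∀ i → InYF (λ k → y (i + k))
InYF-shift {y} yF i k n inF = yF (i + k) n (subst InF (shift k n) inF)
  where
  shift : ∀ k n → factor (λ k → y (i + k)) k n ≡ factor y (i + k) n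
  shift k zero    = refl
  shift k (suc n) = cong (y (i + k) ∷_) (trans (shift (suc k) n) (cong (λ q → factor y q n) (+-suc i k)))

-- Excluding the configuration of a minimal imbalance.

-- The configuration of a minimal imbalance: a p a at 0 and b p b at suc j, where p is a palindrome
-- of length w; periodicity says that the windows of length 2 + w strictly in between have equal weight.
module Collision
  {y : InfWord} {a b : 𝒜} (a≢b : a ≢ b) (a-or-b : ∀ x → x ≡ a ⊎ x ≡ b)
  (noF-ab : NoF a b y) (noF-ba : NoF b a y)
  (w j : ℕ)
  (y0 : y 0 ≡ a) (ym : y (suc w) ≡ a) (yn : y (2 + w) ≡ b)
  (yj : y j ≡ a) (yj+1 : y (suc j) ≡ b) (yj+n : y (suc j + suc w) ≡ b)
  (periodic : ∀ k → 0 < k → k < j → y (k + (2 + w)) ≡ y k)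
  (palindrome : ∀ t u → suc t + suc u ≡ suc w → y (suc t) ≡ y (suc u))
  (repeated : ∀ t u → suc t + suc u ≡ suc w → y (suc t) ≡ y (suc j + suc t))
  where

  private
    m n : ℕ
    m = suc w
    n = suc m

  -- The last letter `a` of the first occurrence falls on the initial `b` of the second or inside
  -- its p. In the latter case, pulling it back to the first p and reflecting there lands on
  -- `suc j`, which carries `b`.
  overlapping : ∀ k → m ≡ suc j + k → ⊥
  overlapping zero    e = a≢b (trans (sym ym) (trans (cong y (trans e (+-identityʳ (suc j)))) yj+1))
  overlapping (suc k) e = a≢b (trans (sym ym) (trans (cong y e)
    (trans (sym (repeated k j (trans (+-comm (suc k) (suc j)) (sym e))))
           (trans (sym (palindrome j k (sym e))) yj+1))))

  adjacent : m ≡ j → ⊥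
  adjacent refl = noF-ab m 0 w refl y0 ym yn yj+n λ x u e →
    let e′ = trans (+-suc (suc x) u) (cong suc e) in
    trans (palindrome x u e′) (repeated u x (trans (+-comm (suc u) (suc x)) e′))

  module Apart (e : ℕ) (j≡ : j ≡ n + suc e) where

    -- Here `l` stands for `j - suc s`, so the property is vacuous once `s ≥ j`.
    Reflects : ℕ → Set
    Reflects s = ∀ l → l + suc s ≡ j → y l ≡ y (suc j + suc s)

    k<j : ∀ k s → k + suc s ≡ j → k < j
    k<j k s e = subst (k <_) e (m<m+n k (s≤s z≤n))

    -- Reflection about (j , suc j) followed by two periods is reflection about (j + n , suc j + n).
    second-centre : ∀ t l → l + suc (m + suc t) ≡ j → (∀ {s} → s < m + suc t → Reflects s) →
      y (l + n + n) ≡ b → y (suc j + suc (m + suc t)) ≡ a → ⊥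
    second-centre t l eq ih yL yR =
      noF-ba (j + n) (l + n + n) t
        (trans (arith₁ l t w) (cong (_+ n) eq))
        yL
        (trans (cong y (+-suc j m)) yj+n)
        yc+1
        (trans (cong y (arith₂ j w t)) yR)
        agree
      where
      arith₁ : ∀ l t w → l + suc (suc w) + suc (suc w) + suc t ≡ l + suc (suc w + suc t) + suc (suc w)
      arith₁ = solve-∀
      arith₂ : ∀ j w t → suc (j + suc (suc w)) + suc t ≡ suc j + suc (suc w + suc t)
      arith₂ = solve-∀
      arith₃ : ∀ l t w → l + suc t + suc (suc w) ≡ l + suc (suc w + suc t)
      arith₃ = solve-∀
      arith₄ : ∀ l x u w → l + suc x + suc (suc w + suc u) ≡ l + suc (suc w + suc (suc (x + u)))
      arith₄ = solve-∀
      arith₅ : ∀ l x w → l + suc (suc w) + suc (suc w) + suc x ≡ l + suc x + suc (suc w) + suc (suc w)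
      arith₅ = solve-∀
      arith₆ : ∀ l x u w → l + suc x + suc (suc w) + suc u ≡ l + suc (suc w + suc (suc (x + u)))
      arith₆ = solve-∀
      0<l+ : ∀ x → 0 < l + suc x
      0<l+ x = subst (0 <_) (sym (+-suc l x)) (s≤s z≤n)
      -- The letter `a` at `j` moves back one period to `j - n`, then reflects about `(j , suc j)`.
      yc+1 : y (suc (j + n)) ≡ a
      yc+1 = trans (sym (ih (m<m+n m (s≤s z≤n)) (l + suc t) (trans (arith₃ l t w) eq)))
        (trans (sym (periodic (l + suc t) (0<l+ t) (k<j _ m (trans (arith₃ l t w) eq))))
               (trans (cong y (trans (arith₃ l t w) eq)) yj))
      agree : ∀ x u → suc (x + u) ≡ t → y (l + n + n + suc x) ≡ y (suc (j + n) + suc u)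
      agree x u refl = begin
        y (l + n + n + suc x)           ≡⟨ cong y (arith₅ l x w) ⟩
        y (l + suc x + n + n)           ≡⟨ periodic (l + suc x + n) (≤-trans (0<l+ x) (m≤m+n _ n))
                                             (k<j _ u (trans (arith₆ l x u w) eq)) ⟩
        y (l + suc x + n)               ≡⟨ periodic (l + suc x) (0<l+ x)
                                             (k<j _ (m + suc u) (trans (arith₄ l x u w) eq)) ⟩
        y (l + suc x)                   ≡⟨ ih (+-monoʳ-< m (s≤s (s≤s (m≤n+m u x)))) (l + suc x)
                                             (trans (arith₄ l x u w) eq) ⟩
        y (suc j + suc (m + suc u))     ≡⟨ cong y (arith₂ j w u) ⟨
        y (suc (j + n) + suc u)         ∎
        where open ≡-Reasoning

    0<left : ∀ l s k → l + suc s ≡ j → s + k ≡ m → 0 < l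
    0<left (suc l) s k eq eq′ = s≤s z≤n
    0<left zero    s k eq eq′ = ⊥-elim (<-irrefl refl (≤-trans (s≤s s≤m) (≤-trans (m≤m+n n e)
      (≤-reflexive (suc-injective (trans (sym (+-suc n e)) (trans (sym j≡) (sym eq))))))))
      where
      s≤m : s ≤ m
      s≤m = subst (s ≤_) eq′ (m≤m+n s k)

    -- The reflected letters agree within the first period because p is a palindrome; beyond it the
    -- pair (a , b) is forbidden at the centre (j , suc j) and the pair (b , a) at (j + n , suc j + n).
    reflects : ∀ s → Reflects s
    reflects = <-rec Reflects step
      where
      step : ∀ s → (∀ {s′} → s′ < s → Reflects s′) → Reflects s
      step s ih l eq with compare s w
      ... | less .s k = begin
        y l                   ≡⟨ periodic l (0<left l s (2 + k) eq (arith₁ s k)) (k<j l s eq) ⟨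
        y (l + n)             ≡⟨ cong y (trans (arith₂ l s k) (cong (λ q → suc q + suc k) eq)) ⟩
        y (suc j + suc k)     ≡⟨ repeated k s (arith₃ k s) ⟨
        y (suc k)             ≡⟨ palindrome k s (arith₃ k s) ⟩
        y (suc s)             ≡⟨ repeated s k (arith₄ s k) ⟩
        y (suc j + suc s)     ∎
        where
        open ≡-Reasoning
        arith₁ : ∀ s k → s + (2 + k) ≡ 2 + (s + k)
        arith₁ = solve-∀
        arith₂ : ∀ l s k → l + suc (suc (suc (s + k))) ≡ suc (l + suc s) + suc k
        arith₂ = solve-∀
        arith₃ : ∀ k s → suc k + suc s ≡ suc (suc (s + k))
        arith₃ = solve-∀
        arith₄ : ∀ s k → suc s + suc k ≡ suc (suc (s + k))
        arith₄ = solve-∀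
      -- One period after `l` comes `suc j`, so the two letters compared are the ends of b p b.
      ... | equal .w = trans (sym (periodic l (0<left l w 1 eq (+-comm w 1)) (k<j l w eq)))
        (trans (cong y (trans (+-suc l m) (cong suc eq))) (trans yj+1 (sym yj+n)))
      ... | greater .w k with a-or-b (y l) | a-or-b (y (suc j + suc (m + k)))
      ...   | inj₁ p | inj₁ q = trans p (sym q)
      ...   | inj₂ p | inj₂ q = trans p (sym q)
      ...   | inj₁ p | inj₂ q = ⊥-elim (noF-ab j l (m + k) eq p yj yj+1 q λ x u e′ →
          ih (subst (u <_) e′ (s≤s (m≤n+m u x))) (l + suc x)
            (trans (arith l x u) (trans (cong (λ z → l + suc z) e′) eq)))
        where
        arith : ∀ l x u → l + suc x + suc u ≡ l + suc (suc (x + u))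
        arith = solve-∀
      step s ih zero    eq | greater .w k | inj₂ p | inj₁ q = ⊥-elim (a≢b (trans (sym y0) p))
      -- The left position is exactly one period before `j`, which carries `a`.
      step s ih (suc l) eq | greater .w zero | inj₂ p | inj₁ q =
        ⊥-elim (a≢b (trans (sym yj) (trans (cong y (sym eq′))
          (trans (periodic (suc l) (s≤s z≤n) (k<j (suc l) m eq′)) p))))
        where
        eq′ : suc l + n ≡ j
        eq′ = trans (cong (λ z → suc l + suc (suc z)) (sym (+-identityʳ w))) eq
      step s ih (suc l) eq | greater .w (suc k) | inj₂ p | inj₁ q =
        ⊥-elim (second-centre k (suc l) eq ih
          (trans (periodic (suc l + n) (s≤s z≤n) (k<j (suc l + n) k (trans (arith l w k) eq)))
            (trans (periodic (suc l) (s≤s z≤n) (k<j (suc l) _ eq)) p)) q)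
        where
        arith : ∀ l w k → suc l + suc (suc w) + suc k ≡ suc l + suc (suc w + suc k)
        arith = solve-∀

    absurd : ⊥
    -- Periodicity does not relate 0 to `n`: the `b` at `n + n` comes from the one at `n`, while the
    -- right-hand `a` is the reflection of the `a` at 0.
    absurd = second-centre e 0 (sym j≡) (λ _ → reflects _)
      (trans (periodic n (s≤s z≤n) (k<j n e (sym j≡))) yn)
      (trans (sym (reflects (m + suc e) 0 (sym j≡))) y0)

  collision : ⊥
  collision with compare j m
  ... | less .j k    = overlapping k refl
  ... | equal .j     = adjacent refl
  -- The gap is a single letter, at `n = j`, which would be both `a` and `b`.
  ... | greater .m zero    = a≢b (trans (sym yj) (trans (cong y (+-identityʳ n)) yn))
  ... | greater .m (suc k) = Apart.absurd k refl

-- Window weights and the structure of a minimal imbalance.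

split-excess : ∀ {p q p′ q′} → 2 + (p + q) ≤ p′ + q′ → p′ ≤ suc p → q′ ≤ suc q → p′ ≡ suc p × q′ ≡ suc q
split-excess {p} {q} {p′} {q′} h hp hq =
  ≤-antisym hp (+-cancelʳ-≤ (suc q) (suc p) p′ (≤-trans h′ (+-monoʳ-≤ p′ hq))) ,
  ≤-antisym hq (+-cancelˡ-≤ (suc p) (suc q) q′ (≤-trans h′ (+-monoˡ-≤ q′ hp)))
  where
  h′ : suc p + suc q ≤ p′ + q′
  h′ = ≤-trans (≤-reflexive (cong suc (+-suc p q))) h

module _ (b : 𝒜) (y : InfWord) where

  weight : ℕ → ℕ → ℕ
  weight i n = occ b (factor y i n)

  weight-+ : ∀ i k l → weight i (k + l) ≡ weight i k + weight (i + k) l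
  weight-+ i k l = trans (cong (occ b) (factor-+ y i k l)) (occ-++ b (factor y i k) _)

  weight-suc : ∀ i n → weight i (suc n) ≡ weight i n + δ b (y (i + n))
  weight-suc i n = trans (cong (weight i) (+-comm 1 n))
    (trans (weight-+ i n 1) (cong (weight i n +_) (+-identityʳ _)))

  -- A slide trades the letter at `i` for the one at `i + n`. This and the next two results compare
  -- both ways of splitting the window of length `suc n` at `i`.
  weight-slide-≤ : ∀ i n → weight (suc i) n ≤ suc (weight i n)
  weight-slide-≤ i n = begin
    weight (suc i) n                  ≤⟨ m≤n+m _ (δ b (y i)) ⟩
    weight i (suc n)                  ≡⟨ weight-suc i n ⟩
    weight i n + δ b (y (i + n))      ≤⟨ +-monoʳ-≤ (weight i n) (δ≤1 b _) ⟩
    weight i n + 1                    ≡⟨ +-comm _ 1 ⟩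
    suc (weight i n)                  ∎
    where open ≤-Reasoning

  weight-slide-up : ∀ i n → suc (weight i n) ≤ weight (suc i) n → y i ≡ opp b × y (i + n) ≡ b
  weight-slide-up i n h = δ-jump b (+-cancelˡ-≤ (weight i n) _ _ (begin
    weight i n + suc (δ b (y i))      ≡⟨ +-comm (weight i n) _ ⟩
    suc (δ b (y i)) + weight i n      ≡⟨ +-suc (δ b (y i)) _ ⟨
    δ b (y i) + suc (weight i n)      ≤⟨ +-monoʳ-≤ (δ b (y i)) h ⟩
    weight i (suc n)                  ≡⟨ weight-suc i n ⟩
    weight i n + δ b (y (i + n))      ∎))
    where open ≤-Reasoning

  weight-slide-≡ : ∀ i n → weight i n ≡ weight (suc i) n → y (i + n) ≡ y i
  weight-slide-≡ i n h = δ-injective b (+-cancelˡ-≡ (weight i n) _ _ (begin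
    weight i n + δ b (y (i + n))      ≡⟨ weight-suc i n ⟨
    δ b (y i) + weight (suc i) n      ≡⟨ +-comm (δ b (y i)) _ ⟩
    weight (suc i) n + δ b (y i)      ≡⟨ cong (_+ δ b (y i)) h ⟨
    weight i n + δ b (y i)            ∎))
    where open ≡-Reasoning

  BalancedAt : ℕ → Set
  BalancedAt n = ∀ i j → weight i n ≤ suc (weight j n)

  module MinimalImbalance (w : ℕ) (bal : ∀ {k} → k < 2 + w → BalancedAt k)
    (i j : ℕ) (imbalance : 2 + weight i (2 + w) ≤ weight j (2 + w)) where

    private
      m n : ℕ
      m = suc w
      n = suc m

    -- Both pieces of a proper split are shorter than `n`, hence balanced, so each carries exactly
    -- one unit of the excess.
    parts : ∀ k l → suc k + suc l ≡ n →
      weight j (suc k) ≡ suc (weight i (suc k)) × weight (j + suc k) (suc l) ≡ suc (weight (i + suc k) (suc l))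
    parts k l e = split-excess
      (subst₂ (λ p q → 2 + p ≤ q) (part i) (part j) imbalance)
      (bal (subst (suc k <_) e (m<m+n (suc k) (s≤s z≤n))) j i)
      (bal (subst (suc l <_) e (m<n+m (suc l) (s≤s z≤n))) _ _)
      where
      part : ∀ i → weight i n ≡ weight i (suc k) + weight (i + suc k) (suc l)
      part i = trans (cong (weight i) (sym e)) (weight-+ i (suc k) (suc l))

    -- By `parts`, prefix and suffix at `j` are one heavier than those at `i`. Balance of each
    -- against the opposite piece at `i` gives the two inequalities.
    prefix≡suffix : ∀ k l → suc k + suc l ≡ n → weight (i + suc k) (suc l) ≡ weight i (suc l)
    prefix≡suffix k l e = ≤-antisym
      (≤-pred (subst (_≤ suc (weight i (suc l))) (proj₂ (parts k l e)) (bal l<n _ i)))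
      (≤-pred (subst (_≤ suc (weight (i + suc k) (suc l)))
        (proj₁ (parts l k (trans (+-comm (suc l) (suc k)) e))) (bal l<n j _)))
      where
      l<n : suc l < n
      l<n = subst (suc l <_) e (m<n+m (suc l) (s≤s z≤n))

    first : y i ≡ opp b × y j ≡ b
    first = δ-jump b (≤-reflexive (sym
      (subst₂ (λ p q → q ≡ suc p) (+-identityʳ _) (+-identityʳ _) (proj₁ (parts 0 w refl)))))

    last : y (i + m) ≡ opp b × y (j + m) ≡ b
    last = δ-jump b (≤-reflexive (sym
      (subst₂ (λ p q → q ≡ suc p) (+-identityʳ _) (+-identityʳ _) (proj₂ (parts w 0 (+-comm m 1))))))

    -- Prefix and suffix weights agree at lengths `suc u` and `2 + u`; the difference isolates one
    -- letter on each side.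
    palindrome : ∀ t u → suc t + suc u ≡ m → y (i + suc t) ≡ y (i + suc u)
    palindrome t u e = δ-injective b (+-cancelʳ-≡ (weight i (suc u)) _ _ (begin
      δ b (y (i + suc t)) + weight i (suc u)                  ≡⟨ cong (δ b (y (i + suc t)) +_) inner ⟨
      weight (i + suc t) (2 + u)                              ≡⟨ prefix≡suffix t (suc u) e′ ⟩
      weight i (2 + u)                                        ≡⟨ weight-suc i (suc u) ⟩
      weight i (suc u) + δ b (y (i + suc u))                  ≡⟨ +-comm (weight i (suc u)) _ ⟩
      δ b (y (i + suc u)) + weight i (suc u)                  ∎))
      where
      open ≡-Reasoning
      e′ = trans (+-suc (suc t) (suc u)) (cong suc e)
      inner : weight (suc (i + suc t)) (suc u) ≡ weight i (suc u)
      inner = trans (cong (λ k → weight k (suc u)) (sym (+-suc i (suc t)))) (prefix≡suffix (suc t) u (cong suc e))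

    repeated : ∀ t u → suc t + suc u ≡ m → y (i + suc t) ≡ y (j + suc t)
    repeated t u e = sym (δ-injective b (+-cancelˡ-≡ (weight j (suc t)) _ _ (begin
      weight j (suc t) + δ b (y (j + suc t))        ≡⟨ weight-suc j (suc t) ⟨
      weight j (2 + t)                              ≡⟨ proj₁ (parts (suc t) u (cong suc e)) ⟩
      suc (weight i (2 + t))                        ≡⟨ cong suc (weight-suc i (suc t)) ⟩
      suc (weight i (suc t)) + δ b (y (i + suc t))  ≡⟨ cong (_+ δ b (y (i + suc t))) (proj₁ (parts t (suc u) e′)) ⟨
      weight j (suc t) + δ b (y (i + suc t))        ∎)))
      where
      open ≡-Reasoning
      e′ = trans (+-suc (suc t) (suc u)) (cong suc e)

  -- Descent on the distance d makes all windows strictly between i and i + d have weight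
  -- exactly one more than the window at i.
  no-rise : InYF y → ∀ n → (∀ {k} → k < n → BalancedAt k) →
    ∀ d i → 2 + weight i n ≤ weight (i + d) n → ⊥
  no-rise yF 0 bal d i ()
  no-rise yF 1 bal d i h = <-irrefl refl (≤-trans (s≤s (s≤s z≤n)) (≤-trans h
    (≤-trans (≤-reflexive (+-identityʳ _)) (δ≤1 b _))))
  no-rise yF (suc (suc w)) bal = <-rec (λ d → ∀ i → 2 + weight i n ≤ weight (i + d) n → ⊥) step
    where
    n = suc (suc w)
    step : ∀ d → (∀ {d′} → d′ < d → ∀ i → 2 + weight i n ≤ weight (i + d′) n → ⊥) →
      ∀ i → 2 + weight i n ≤ weight (i + d) n → ⊥
    step 0 ih i h = <-irrefl refl (≤-trans (n≤1+n _) (subst (λ k → 2 + weight i n ≤ weight k n) (+-identityʳ i) h))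
    step 1 ih i h = <-irrefl refl (≤-trans (subst (λ k → 2 + weight i n ≤ weight k n) (+-comm i 1) h)
      (weight-slide-≤ i n))
    step d@(suc (suc j)) ih i h = Collision.collision (opp≢ b) (opp-or-same b)
      (noF zF (opp b) b (opp≢ b)) (noF zF b (opp b) (≢-sym (opp≢ b)))
      w (suc j)
      (trans (cong y (+-identityʳ i)) (proj₁ M.first))
      (proj₁ M.last)
      -- The weight rises on the first slide and on the last, which fixes the first letter to enter
      -- and the last to leave.
      (proj₂ (weight-slide-up i n (≤-reflexive (sym
        (trans (cong (λ k → weight k n) (+-comm 1 i)) (between 0 j refl))))))
      (proj₁ (weight-slide-up (i + suc j) n (≤-trans (s≤s (≤-reflexive (between j 0 (+-comm (suc j) 1))))
        (subst (λ k → 2 + weight i n ≤ weight k n) (+-suc i (suc j)) h))))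
      (proj₂ M.first)
      (trans (cong y (sym (+-assoc i d (suc w)))) (proj₂ M.last))
      periodic
      M.palindrome
      (λ t u e → trans (M.repeated t u e) (cong y (+-assoc i d (suc t))))
      where
      zF = InYF-shift yF i
      module M = MinimalImbalance w bal i (i + d) h
      between : ∀ k l → suc k + suc l ≡ d → weight (i + suc k) n ≡ suc (weight i n)
      -- Too heavy a window gives a closer rise from `i`, too light a one a closer rise up to
      -- `i + d`.
      between k l e = ≤-antisym
        (≤-pred (≰⇒> (ih (subst (suc k <_) e (m<m+n (suc k) (s≤s z≤n))) i)))
        (≰⇒> λ low → ih (subst (suc l <_) e (m<n+m (suc l) (s≤s z≤n))) (i + suc k)
          (≤-trans (s≤s (s≤s low)) (subst (λ k → 2 + weight i n ≤ weight k n)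
            (trans (cong (i +_) (sym e)) (sym (+-assoc i (suc k) (suc l)))) h)))
      periodic : ∀ k → 0 < k → k < suc j → y (i + (k + n)) ≡ y (i + k)
      periodic (suc k) _ k<j with m≤n⇒∃[o]m+o≡n k<j
      ... | l , e = trans (cong y (sym (+-assoc i (suc k) n)))
        (weight-slide-≡ (i + suc k) n
          (trans (between k (suc l) (trans (+-suc (suc k) (suc l)) e′))
            (sym (trans (cong (λ q → weight q n) (sym (+-suc i (suc k)))) (between (suc k) l e′)))))
        where
        e′ : suc (suc k + suc l) ≡ d
        e′ = trans (+-suc (suc (suc k)) l) (cong suc e)

-- Avoidance of F implies balance.

occ-complement : ∀ (y : InfWord) i j n → 2 + occ 𝟏 (factor y j n) ≤ occ 𝟏 (factor y i n) →
  2 + occ 𝟎 (factor y i n) ≤ occ 𝟎 (factor y j n)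
occ-complement y i j n h = +-cancelʳ-≤ (occ 𝟏 (factor y j n)) _ _ (begin
  2 + zeros i + ones j      ≡⟨ cong (_+ ones j) (+-comm 2 (zeros i)) ⟩
  zeros i + 2 + ones j      ≡⟨ +-assoc (zeros i) 2 _ ⟩
  zeros i + (2 + ones j)    ≤⟨ +-monoʳ-≤ (zeros i) h ⟩
  zeros i + ones i          ≡⟨ total i ⟩
  n                         ≡⟨ total j ⟨
  zeros j + ones j          ∎)
  where
  open ≤-Reasoning
  zeros ones : ℕ → ℕ
  zeros k = occ 𝟎 (factor y k n)
  ones  k = occ 𝟏 (factor y k n)
  total : ∀ k → zeros k + ones k ≡ n
  total k = trans (occ-total (factor y k n)) (length-factor y k n)

balanced-complement : ∀ y n → BalancedAt 𝟏 y n → BalancedAt 𝟎 y n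
balanced-complement y n bal i j = +-cancelʳ-≤ (occ 𝟏 (factor y i n)) _ _ (begin
  zeros i + ones i          ≡⟨ total i ⟩
  n                         ≡⟨ total j ⟨
  zeros j + ones j          ≤⟨ +-monoʳ-≤ (zeros j) (bal j i) ⟩
  zeros j + suc (ones i)    ≡⟨ +-suc (zeros j) _ ⟩
  suc (zeros j) + ones i    ∎)
  where
  open ≤-Reasoning
  zeros ones : ℕ → ℕ
  zeros k = occ 𝟎 (factor y k n)
  ones  k = occ 𝟏 (factor y k n)
  total : ∀ k → zeros k + ones k ≡ n
  total k = trans (occ-total (factor y k n)) (length-factor y k n)

InYF⇒BalancedAt : ∀ {y} → InYF y → ∀ n → BalancedAt 𝟏 y n
InYF⇒BalancedAt {y} yF = <-rec (BalancedAt 𝟏 y) step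
  where
  step : ∀ n → (∀ {k} → k < n → BalancedAt 𝟏 y k) → BalancedAt 𝟏 y n
  step n ih i j with weight 𝟏 y i n ≤? suc (weight 𝟏 y j n)
  ... | yes ok = ok
  ... | no ¬ok with ≤-total i j
  ...   | inj₁ i≤j with m≤n⇒∃[o]m+o≡n i≤j
  ...     | d , refl = ⊥-elim (no-rise 𝟎 y yF n (λ {k} k<n → balanced-complement y k (ih k<n)) d i
                         (occ-complement y i j n (≰⇒> ¬ok)))
  step n ih i j | no ¬ok | inj₂ j≤i with m≤n⇒∃[o]m+o≡n j≤i
  ...     | d , refl = ⊥-elim (no-rise 𝟏 y yF n ih d j (≰⇒> ¬ok))

∣-∣≤1 : ∀ {m n} → m ≤ suc n → n ≤ suc m → ∣ m - n ∣ ≤ 1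
∣-∣≤1 {zero}  {n}     _       q       = q
∣-∣≤1 {suc m} {zero}  p       _       = p
∣-∣≤1 {suc m} {suc n} (s≤s p) (s≤s q) = ∣-∣≤1 p q

InYF⇒Balanced : ∀ {y} → InYF y → Balanced y
InYF⇒Balanced {y} yF i j n = ∣-∣≤1 (bound i j) (bound j i)
  where
  bound : ∀ i j → count₁ (factor y i n) ≤ suc (count₁ (factor y j n))
  bound i j = subst₂ (λ p q → p ≤ suc q) (occ-𝟏 (factor y i n)) (occ-𝟏 (factor y j n))
    (InYF⇒BalancedAt yF n i j)

-- Balance implies avoidance of F.

same-length-factors : ∀ {y i n} u w → length u ≡ length w → factor y i n ≡ u ++ w → Balanced y →
  ∣ occ 𝟏 u - occ 𝟏 w ∣ ≤ 1
same-length-factors {y} {i} {n} u w len eq bal with factor-++⁻ y i n u w eq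
... | p , q = subst₂ (λ p q → ∣ p - q ∣ ≤ 1)
  (trans (cong count₁ p) (sym (occ-𝟏 u)))
  (trans (cong count₁ (trans (cong (factor y (i + length u)) len) q)) (sym (occ-𝟏 w)))
  (bal i (i + length u) (length u))

occ-∷ʳ : ∀ b w x → occ b (w ∷ʳ x) ≡ δ b x + occ b w
occ-∷ʳ b w x = trans (occ-++ b w [ x ]) (trans (+-comm (occ b w) _) (cong (_+ occ b w) (+-identityʳ (δ b x))))

flank-gap : ∀ x o → ∣ δ 𝟏 x + (δ 𝟏 x + o) - δ 𝟏 (opp x) + (δ 𝟏 (opp x) + o) ∣ ≡ 2
flank-gap 𝟎 o = trans (cong (∣ o -_∣) (+-comm 2 o)) (∣m-m+n∣≡n o 2)
flank-gap 𝟏 o = trans (∣-∣-comm (2 + o) o) (flank-gap 𝟎 o)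

-- The flanking letters alone make the halves differ by 2. Only the length and the number of ones of
-- a mirror pair enter, so both families of F are covered.
no-flanked-pair : ∀ {y} → Balanced y → ∀ {i n} x p q → length p ≡ length q → occ 𝟏 p ≡ occ 𝟏 q →
  factor y i n ≢ x ∷ p ++ x ∷ opp x ∷ q ++ [ opp x ]
no-flanked-pair bal x p q len occ≡ eq = <-irrefl refl (begin-strict
  1
    <⟨ ≤-refl ⟩
  2
    ≡⟨ flank-gap x (occ 𝟏 p) ⟨
  ∣ δ 𝟏 x + (δ 𝟏 x + occ 𝟏 p) - x̄ + (x̄ + occ 𝟏 p) ∣
    ≡⟨ cong (λ o → ∣ δ 𝟏 x + (δ 𝟏 x + occ 𝟏 p) - x̄ + (x̄ + o) ∣) occ≡ ⟩
  ∣ δ 𝟏 x + (δ 𝟏 x + occ 𝟏 p) - x̄ + (x̄ + occ 𝟏 q) ∣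
    ≡⟨ cong₂ (λ k l → ∣ δ 𝟏 x + k - x̄ + l ∣) (occ-∷ʳ 𝟏 p x) (occ-∷ʳ 𝟏 q (opp x)) ⟨
  ∣ occ 𝟏 (x ∷ p ∷ʳ x) - occ 𝟏 (opp x ∷ q ∷ʳ opp x) ∣
    ≤⟨ same-length-factors (x ∷ p ∷ʳ x) (opp x ∷ q ∷ʳ opp x) lens eq′ bal ⟩
  1 ∎)
  where
  open ≤-Reasoning
  x̄ = δ 𝟏 (opp x)
  lens : length (x ∷ p ∷ʳ x) ≡ length (opp x ∷ q ∷ʳ opp x)
  lens = cong suc (trans (length-++ p) (trans (cong (_+ 1) len) (sym (length-++ q))))
  eq′ = trans eq (cong (x ∷_) (sym (++-assoc p [ x ] _)))

Balanced⇒InYF : ∀ {y} → Balanced y → InYF y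
Balanced⇒InYF bal i n (inj₁ (v , eq)) =
  no-flanked-pair bal 𝟎 v (mirror v) (sym (length-reverse v)) (sym (occ-reverse 𝟏 v)) eq
Balanced⇒InYF bal i n (inj₂ (v , eq)) =
  no-flanked-pair bal 𝟏 (mirror v) v (length-reverse v) (occ-reverse 𝟏 v) eq

theorem5p10 : (y : InfWord) → (InYF y → Balanced y) × (Balanced y → InYF y)
theorem5p10 y = InYF⇒Balanced , Balanced⇒InYF
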